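{- Let $L=\{E\}$ be the language of (finite, undirected, loopless) graphs. For each $k\geq 1$, let $\phi_k(x)$ be the first-order property "$x$ is adjacent to exactly $k$ nodes". Then $d(\phi_k:\mathrm{typ})=0$.
   Context: $L$-structures are graphs $G=\langle A,E\rangle$ with $E$ a symmetric irreflexive binary relation on $A$; $\mathbf{S}_n(L)$ is the set of all such graphs with node set $\{1,\ldots,n\}$, so $|\mathbf{S}_n(L)|=2^{\binom{n}{2}}$. For a first-order formula $\phi(x)$ of $L$ with one free variable and a graph $G$ with node set $A$, $\phi(G)=\{a\in A:G\models\phi(a)\}$. Let $\mathbf{S}_n(\phi:\mathrm{typ})=\{G\in\mathbf{S}_n(L):|\phi(G)|>n/2\}$, $d_n(\phi:\mathrm{typ})=|\mathbf{S}_n(\phi:\mathrm{typ})|/|\mathbf{S}_n(L)|$, and $d(\phi:\mathrm{typ})=\lim_{n\to\infty}d_n(\phi:\mathrm{typ})$ whenever this limit exists. -}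

module Defs where

open import Data.Bool.Base using (Bool; true; false; T; if_then_else_)
open import Data.Empty using (⊥; ⊥-elim)
open import Data.Fin.Base using (Fin; zero; suc; _↑ˡ_; _↑ʳ_)
import Data.Fin.Properties as Fin
open import Data.Integer.Base using (+_)
open import Data.List.Base using (List; []; _∷_; length; filter; allFin; cartesianProductWith)
open import Data.List.Membership.Propositional using (_∈_)
open import Data.List.Membership.Propositional.Properties
  using (∈-cartesianProductWith⁺; ∈-filter⁺; ∈-filter⁻; ∈-length)
open import Data.List.Relation.Unary.All using ([]; _∷_)
open import Data.List.Relation.Unary.AllPairs using ([]; _∷_)
open import Data.List.Relation.Unary.Any using (here; there)
open import Data.List.Relation.Unary.Unique.Propositional using (Unique)
import Data.List.Relation.Unary.Unique.Propositional.Properties as Unique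
open import Data.Nat.Base as ℕ using (ℕ; zero; suc; NonZero)
import Data.Nat.Properties as ℕ
open import Data.Product.Base using (_×_; _,_; proj₂; ∃-syntax)
open import Data.Rational.Base using (ℚ; 0ℚ; _/_; _-_; ∣_∣; _<_)
open import Data.Sum.Base using (_⊎_)
open import Data.Vec.Base using (Vec; []; _∷_; lookup; replicate)
open import Data.Vec.Functional using (Vector; foldr)
open import Data.Vec.Properties using (∷-injective; lookup-replicate)
open import Relation.Binary.Core using (Rel)
open import Relation.Binary.Definitions using (Symmetric; Irreflexive)
open import Relation.Binary.PropositionalEquality.Core using (_≡_; refl; subst; cong; trans)
open import Relation.Nullary.Decidable
  using (Dec; yes; no; does; map′; T?; _×-dec_; _⊎-dec_; _→-dec_; ¬?)
open import Relation.Nullary.Negation.Core using (¬_)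
open import Level using (0ℓ)

-- A binary relation on the node set, as a 0/1 matrix; Fin n stands for
-- {1,…,n}.  Matrices rather than functions, so that relations with the
-- same pairs are propositionally equal and can be counted up to _≡_.
Structure : ℕ → Set
Structure n = Vec (Vec Bool n) n

Adj : ∀ {n} → Structure n → Rel (Fin n) 0ℓ
Adj G i j = T (lookup (lookup G i) j)

adj? : ∀ {n} (G : Structure n) i j → Dec (Adj G i j)
adj? G i j = T? (lookup (lookup G i) j)

IsGraph : ∀ {n} → Structure n → Set
IsGraph G = Symmetric (Adj G) × Irreflexive _≡_ (Adj G)

isGraph? : ∀ {n} (G : Structure n) → Dec (IsGraph G)
isGraph? G =
  map′ (λ s {i} {j} → s i j) (λ s i j → s {i} {j})
    (Fin.all? λ i → Fin.all? λ j → adj? G i j →-dec adj? G j i)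
  ×-dec
  map′ (λ r {i} {j} → λ { refl → r i }) (λ r i → r {i} {i} refl)
    (Fin.all? λ i → ¬? (adj? G i i))

allVecs : {A : Set} → List A → ∀ n → List (Vec A n)
allVecs xs zero    = [] ∷ []
allVecs xs (suc n) = cartesianProductWith _∷_ xs (allVecs xs n)

structures : ∀ n → List (Structure n)
structures n = allVecs (allVecs (true ∷ false ∷ []) n) n

-- The set S_n(L), listed without repetition (graphs-complete,
-- graphs-sound and graphs-unique below).
graphs : ∀ n → List (Structure n)
graphs n = filter isGraph? (structures n)

allVecs-complete : {A : Set} {xs : List A} → (∀ x → x ∈ xs) →
                   ∀ {n} (v : Vec A n) → v ∈ allVecs xs n
allVecs-complete c []      = here refl
allVecs-complete c (x ∷ v) =
  ∈-cartesianProductWith⁺ _∷_ (c x) (allVecs-complete c v)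

allVecs-unique : {A : Set} {xs : List A} → Unique xs → ∀ n → Unique (allVecs xs n)
allVecs-unique u zero    = [] ∷ []
allVecs-unique u (suc n) =
  Unique.cartesianProductWith⁺ _∷_ ∷-injective u (allVecs-unique u n)

graphs-complete : ∀ {n} (G : Structure n) → IsGraph G → G ∈ graphs n
graphs-complete G = ∈-filter⁺ isGraph? (allVecs-complete (allVecs-complete bools) G)
  where
  bools : ∀ b → b ∈ true ∷ false ∷ []
  bools true  = here refl
  bools false = there (here refl)

graphs-sound : ∀ {n} {G : Structure n} → G ∈ graphs n → IsGraph G
graphs-sound {n} G∈ = proj₂ (∈-filter⁻ isGraph? {xs = structures n} G∈)

graphs-unique : ∀ n → Unique (graphs n)
graphs-unique n = Unique.filter⁺ isGraph? (allVecs-unique (allVecs-unique bools n) n)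
  where
  bools : Unique (true ∷ false ∷ [])
  bools = ((λ ()) ∷ []) ∷ [] ∷ []

edgeless : ∀ n → Structure n
edgeless n = replicate n (replicate n false)

edgeless-isGraph : ∀ n → IsGraph (edgeless n)
edgeless-isGraph n = (λ {i} {j} e → ⊥-elim (noEdge i j e)) , λ {i} {j} _ → noEdge i j
  where
  noEdge : ∀ i j → ¬ Adj (edgeless n) i j
  noEdge i j = subst T (trans (cong (λ row → lookup row j) (lookup-replicate i _))
                              (lookup-replicate j false))

graphs-nonZero : ∀ n → NonZero (length (graphs n))
graphs-nonZero n = ℕ.>-nonZero (∈-length (graphs-complete (edgeless n) (edgeless-isGraph n)))

infix  8 _≐_
infixr 6 _∧′_
infixr 5 _∨′_
infixr 4 _⇒′_
infix  3 _⇔′_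

-- Formula m: formulas whose free variables are among m de Bruijn
-- variables; a quantifier binds variable zero of its body.
data Formula : ℕ → Set where
  E    : ∀ {m} → Fin m → Fin m → Formula m
  _≐_  : ∀ {m} → Fin m → Fin m → Formula m
  ⊥′   : ∀ {m} → Formula m
  _∧′_ : ∀ {m} → Formula m → Formula m → Formula m
  _∨′_ : ∀ {m} → Formula m → Formula m → Formula m
  _⇒′_ : ∀ {m} → Formula m → Formula m → Formula m
  ∀′   : ∀ {m} → Formula (suc m) → Formula m
  ∃′   : ∀ {m} → Formula (suc m) → Formula m

¬′_ : ∀ {m} → Formula m → Formula m
¬′ φ = φ ⇒′ ⊥′

⊤′ : ∀ {m} → Formula m
⊤′ = ¬′ ⊥′

_⇔′_ : ∀ {m} → Formula m → Formula m → Formula m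
φ ⇔′ ψ = (φ ⇒′ ψ) ∧′ (ψ ⇒′ φ)

⋀ ⋁ : ∀ {m k} → Vector (Formula m) k → Formula m
⋀ = foldr _∧′_ ⊤′
⋁ = foldr _∨′_ ⊥′

∃^ : ∀ k {m} → Formula (k ℕ.+ m) → Formula m
∃^ zero    φ = φ
∃^ (suc k) φ = ∃^ k (∃′ φ)

infix 2 _,_⊨_

_,_⊨_ : ∀ {n m} → Structure n → Vec (Fin n) m → Formula m → Set
G , ρ ⊨ E x y    = Adj G (lookup ρ x) (lookup ρ y)
G , ρ ⊨ x ≐ y    = lookup ρ x ≡ lookup ρ y
G , ρ ⊨ ⊥′       = ⊥
G , ρ ⊨ (φ ∧′ ψ) = (G , ρ ⊨ φ) × (G , ρ ⊨ ψ)
G , ρ ⊨ (φ ∨′ ψ) = (G , ρ ⊨ φ) ⊎ (G , ρ ⊨ ψ)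
G , ρ ⊨ (φ ⇒′ ψ) = (G , ρ ⊨ φ) → (G , ρ ⊨ ψ)
G , ρ ⊨ ∀′ φ     = ∀ a → G , a ∷ ρ ⊨ φ
G , ρ ⊨ ∃′ φ     = ∃[ a ] (G , a ∷ ρ ⊨ φ)

sat? : ∀ {n m} (G : Structure n) (ρ : Vec (Fin n) m) (φ : Formula m) → Dec (G , ρ ⊨ φ)
sat? G ρ (E x y)  = adj? G (lookup ρ x) (lookup ρ y)
sat? G ρ (x ≐ y)  = lookup ρ x Fin.≟ lookup ρ y
sat? G ρ ⊥′       = no λ ()
sat? G ρ (φ ∧′ ψ) = sat? G ρ φ ×-dec sat? G ρ ψ
sat? G ρ (φ ∨′ ψ) = sat? G ρ φ ⊎-dec sat? G ρ ψ
sat? G ρ (φ ⇒′ ψ) = sat? G ρ φ →-dec sat? G ρ ψ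
sat? G ρ (∀′ φ)   = Fin.all? λ a → sat? G (a ∷ ρ) φ
sat? G ρ (∃′ φ)   = Fin.any? λ a → sat? G (a ∷ ρ) φ

-- φ(G) = {a : G ⊨ φ(a)}
solutions : ∀ {n} → Formula 1 → Structure n → List (Fin n)
solutions {n} φ G = filter (λ a → sat? G (a ∷ []) φ) (allFin n)

-- |φ(G)| > n/2, with the denominator cleared.
Typical : ∀ {n} → Formula 1 → Structure n → Set
Typical {n} φ G = 2 ℕ.* length (solutions φ G) ℕ.> n

typical? : ∀ {n} φ (G : Structure n) → Dec (Typical φ G)
typical? {n} φ G = n ℕ.<? 2 ℕ.* length (solutions φ G)

typicalGraphs : Formula 1 → ∀ n → List (Structure n)
typicalGraphs φ n = filter (typical? φ) (graphs n)

dₙ-typ : Formula 1 → ℕ → ℚ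
dₙ-typ φ n = (+ length (typicalGraphs φ n) / length (graphs n))
               {{graphs-nonZero n}}

_⟶_ : (ℕ → ℚ) → ℚ → Set
s ⟶ l = ∀ ε → 0ℚ < ε → ∃[ N ] (∀ n → n ℕ.≥ N → ∣ s n - l ∣ < ε)

-- d(φ:typ) exists and equals l, for rational l.
d-typ_≔_ : Formula 1 → ℚ → Set
d-typ φ ≔ l = dₙ-typ φ ⟶ l

-- ∃ y₁ … yₖ ( ⋀_{i≠j} yᵢ ≠ yⱼ  ∧  ∀ z (E(x,z) ⇔ ⋁ᵢ z = yᵢ) )
exactlyNeighbours : ℕ → Formula 1
exactlyNeighbours k =
  ∃^ k ( (⋀ λ i → ⋀ λ j → if does (i Fin.≟ j) then ⊤′ else ¬′ (y i ≐ y j))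
       ∧′ ∀′ (E (suc x) zero ⇔′ ⋁ λ i → zero ≐ suc (y i)) )
  where
  y : Fin k → Fin (k ℕ.+ 1)
  y i = i ↑ˡ 1
  x : Fin (k ℕ.+ 1)
  x = k ↑ʳ zero

{-# OPTIONS --safe #-}
-- Switching: adding the missing edge ab turns a graph with deg a ≤ k into one
-- with deg a ≤ k + 1.  A graph of the first kind admits at least n − k choices
-- of b (one of them the excluded b = a), one of the second kind arises from at
-- most k + 1 choices, so at most a fraction (k + 2)/(n − k) of all graphs has
-- deg a ≤ k.  By Markov's inequality at most a fraction 2(k + 2)/(n − k) of
-- them has more than n/2 such nodes a.
module Submission where

open import Defs
open import Data.Bool.Base using (Bool; true; false; T; not; _xor_; if_then_else_)
open import Data.Bool.Properties using (∨-comm; xor-assoc; xor-same; xor-identityʳ)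
open import Data.Empty using (⊥-elim)
open import Data.Fin.Base using (Fin; zero; suc)
open import Data.Fin.Properties using (_≟_)
import Data.Integer.Base as ℤ
import Data.Integer.Properties as ℤ
open import Data.List.Base using (List; []; _∷_; length; filter; map; allFin)
open import Data.List.Membership.Propositional using (_∈_)
open import Data.List.Membership.Propositional.Properties using (∈-map⁺; ∈-map⁻; ∈-allFin)
open import Data.List.Membership.Propositional.Properties.WithK using (unique∧set⇒bag)
open import Data.List.Properties using (length-tabulate; map-∘)
open import Data.List.Relation.Binary.BagAndSetEquality using (∼bag⇒↭)
open import Data.List.Relation.Binary.Permutation.Propositional using (_↭_)
import Data.List.Relation.Binary.Permutation.Propositional.Properties as ↭
open import Data.List.Relation.Unary.All using (All; []; _∷_)
open import Data.List.Relation.Unary.AllPairs using ([]; _∷_)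
open import Data.List.Relation.Unary.Any using (here; there)
open import Data.List.Relation.Unary.Unique.Propositional using (Unique)
import Data.List.Relation.Unary.Unique.Propositional.Properties as Unique
open import Data.Nat.Base
open import Data.Nat.Coprimality using (Coprime)
open import Data.Nat.ListAction using (sum)
open import Data.Nat.ListAction.Properties using (sum-↭)
open import Data.Nat.Properties hiding (_≟_)
open import Data.Nat.Tactic.RingSolver using (solve-∀)
open import Data.Product.Base using (_,_; proj₁; ∃-syntax)
open import Data.Rational.Base as ℚ using (0ℚ; mkℚ)
import Data.Rational.Properties as ℚ
import Data.Rational.Unnormalised.Base as ℚᵘ
import Data.Rational.Unnormalised.Properties as ℚᵘ
open import Data.Sum.Base using (inj₁; inj₂)
open import Data.Vec.Base using (Vec; []; _∷_; lookup; tabulate; _++_)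
open import Data.Vec.Functional using (Vector)
open import Data.Vec.Properties
  using (lookup∘tabulate; tabulate∘lookup; tabulate-cong; lookup-++ˡ; lookup-++ʳ)
open import Function.Base using (_∘_)
open import Function.Bundles using (mk⇔)
open import Level using (0ℓ)
open import Relation.Binary.Definitions using (DecidableEquality)
open import Relation.Binary.PropositionalEquality
open import Relation.Nullary.Decidable
  using (Dec; yes; no; does; dec-true; dec-false; _×-dec_; _⊎-dec_)
open import Relation.Unary using (Pred; Decidable)

private
  variable
    A B : Set
    n k : ℕ

-- Indicators of Booleans and of decidable propositions.

𝟙 : Bool → ℕ
𝟙 b = if b then 1 else 0

𝟙≤1 : ∀ b → 𝟙 b ≤ 1
𝟙≤1 true  = ≤-refl
𝟙≤1 false = z≤n

𝟙-mono : {P Q : Set} (P? : Dec P) (Q? : Dec Q) → (P → Q) → 𝟙 (does P?) ≤ 𝟙 (does Q?)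
𝟙-mono (no _)  _        _ = z≤n
𝟙-mono (yes _) (yes _)  _ = ≤-refl
𝟙-mono (yes p) (no ¬q)  f = ⊥-elim (¬q (f p))

𝟙*≤ : {P : Set} (P? : Dec P) {x y : ℕ} → (P → x ≤ y) → 𝟙 (does P?) * x ≤ y
𝟙*≤ (no _)  _ = z≤n
𝟙*≤ (yes p) f = ≤-trans (≤-reflexive (*-identityˡ _)) (f p)

*𝟙≤𝟙* : {P : Set} (P? : Dec P) {x y : ℕ} → (P → x ≤ y) → x * 𝟙 (does P?) ≤ 𝟙 (does P?) * y
*𝟙≤𝟙* (no _)  {x} _ = ≤-reflexive (*-zeroʳ x)
*𝟙≤𝟙* (yes p) {x} f = ≤-trans (≤-reflexive (*-comm x 1)) (*-monoʳ-≤ 1 (f p))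

𝟙-xor : ∀ x y → 𝟙 (x xor y) ≤ 𝟙 x + 𝟙 y
𝟙-xor false y     = ≤-refl
𝟙-xor true  true  = z≤n
𝟙-xor true  false = ≤-refl

𝟙+𝟙-not : ∀ b → 𝟙 b + 𝟙 (not b) ≡ 1
𝟙+𝟙-not true  = refl
𝟙+𝟙-not false = refl

-- Turns the symmetry of a graph, given as implications, into an equation between matrix entries.
T-ext : ∀ {x y} → (T x → T y) → (T y → T x) → x ≡ y
T-ext {true}  {true}  f g = refl
T-ext {false} {false} f g = refl
T-ext {true}  {false} f g = ⊥-elim (f _)
T-ext {false} {true}  f g = ⊥-elim (g _)

-- Finite sums

∑ : List A → (A → ℕ) → ℕ
∑ xs f = sum (map f xs)

infix 5 ∑
syntax ∑ xs (λ x → e) = ∑[ x ∈ xs ] e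

∑-mono : ∀ (xs : List A) {f g : A → ℕ} → (∀ x → x ∈ xs → f x ≤ g x) → ∑ xs f ≤ ∑ xs g
∑-mono []       h = z≤n
∑-mono (x ∷ xs) h = +-mono-≤ (h x (here refl)) (∑-mono xs λ y → h y ∘ there)

∑-cong : ∀ (xs : List A) {f g : A → ℕ} → (∀ x → f x ≡ g x) → ∑ xs f ≡ ∑ xs g
∑-cong []       h = refl
∑-cong (x ∷ xs) h = cong₂ _+_ (h x) (∑-cong xs h)

∑-+ : ∀ (xs : List A) (f g : A → ℕ) → (∑[ x ∈ xs ] (f x + g x)) ≡ ∑ xs f + ∑ xs g
∑-+ []       f g = refl
∑-+ (x ∷ xs) f g = trans (cong (f x + g x +_) (∑-+ xs f g)) (interchange (f x) (g x) _ _)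
  where
  interchange : ∀ a b c d → a + b + (c + d) ≡ a + c + (b + d)
  interchange = solve-∀

∑-* : ∀ c (xs : List A) (f : A → ℕ) → (∑[ x ∈ xs ] c * f x) ≡ c * ∑ xs f
∑-* c []       f = sym (*-zeroʳ c)
∑-* c (x ∷ xs) f = trans (cong (c * f x +_) (∑-* c xs f)) (sym (*-distribˡ-+ c (f x) _))

∑-const : ∀ (xs : List A) c → (∑[ x ∈ xs ] c) ≡ length xs * c
∑-const []       c = refl
∑-const (x ∷ xs) c = cong (c +_) (∑-const xs c)

∑-comm : ∀ (xs : List A) (ys : List B) (f : A → B → ℕ) →
         (∑[ x ∈ xs ] ∑[ y ∈ ys ] f x y) ≡ (∑[ y ∈ ys ] ∑[ x ∈ xs ] f x y)
∑-comm []       ys f = sym (trans (∑-const ys 0) (*-zeroʳ (length ys)))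
∑-comm (x ∷ xs) ys f = trans (cong (∑ ys (f x) +_) (∑-comm xs ys f)) (sym (∑-+ ys (f x) _))

∑-bij : ∀ {xs : List A} (t : A → A) (f : A → ℕ) → map t xs ↭ xs →
        (∑[ x ∈ xs ] f (t x)) ≡ ∑ xs f
∑-bij {xs = xs} t f p = trans (cong sum (map-∘ xs)) (sum-↭ (↭.map⁺ f p))

length-filter-∑ : ∀ {P : Pred A 0ℓ} (P? : Decidable P) xs →
                  length (filter P? xs) ≡ (∑[ x ∈ xs ] 𝟙 (does (P? x)))
length-filter-∑ P? []       = refl
length-filter-∑ P? (x ∷ xs) with does (P? x)
... | true  = cong suc (length-filter-∑ P? xs)
... | false = length-filter-∑ P? xs

∑-allFin-const : ∀ n c → (∑[ i ∈ allFin n ] c) ≡ n * c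
∑-allFin-const n c = trans (∑-const (allFin n) c) (cong (_* c) (length-tabulate {n = n} _))

module _ (_≟′_ : DecidableEquality A) where

  ∑-δ-∉ : ∀ y {xs} → All (y ≢_) xs → (∑[ x ∈ xs ] 𝟙 (does (y ≟′ x))) ≡ 0
  ∑-δ-∉ y []                 = refl
  ∑-δ-∉ y {x ∷ _} (y≢x ∷ ps) =
    cong₂ _+_ (cong 𝟙 (dec-false (y ≟′ x) y≢x)) (∑-δ-∉ y ps)

  ∑-δ-unique : ∀ y {xs} → Unique xs → (∑[ x ∈ xs ] 𝟙 (does (y ≟′ x))) ≤ 1
  ∑-δ-unique y []                 = z≤n
  ∑-δ-unique y {x ∷ _} (x∉xs ∷ u) with y ≟′ x
  ... | yes refl = s≤s (≤-reflexive (∑-δ-∉ y x∉xs))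
  ... | no _     = ∑-δ-unique y u

∑-δ : (i : Fin n) → (∑[ j ∈ allFin n ] 𝟙 (does (i ≟ j))) ≤ 1
∑-δ i = ∑-δ-unique _≟_ i (Unique.allFin⁺ _)

-- An involution is injective, so the image list is again free of repetitions. It has the same
-- members as `xs`, and two such lists differ only in order.
involution-↭ : ∀ {xs : List A} (t : A → A) → (∀ x → t (t x) ≡ x) →
               (∀ x → x ∈ xs → t x ∈ xs) → Unique xs → map t xs ↭ xs
involution-↭ {xs = xs} t inv closed u =
  ∼bag⇒↭ (unique∧set⇒bag (Unique.map⁺ t-injective u) u (mk⇔ to from))
  where
  t-injective : ∀ {x y} → t x ≡ t y → x ≡ y
  t-injective {x} {y} eq = trans (sym (inv x)) (trans (cong t eq) (inv y))
  to : ∀ {x} → x ∈ map t xs → x ∈ xs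
  to p with _ , y∈ , refl ← ∈-map⁻ t p = closed _ y∈
  from : ∀ {x} → x ∈ xs → x ∈ map t xs
  from {x} p = subst (_∈ map t xs) (inv x) (∈-map⁺ t (closed x p))

-- Degrees and edge switching

entry : Structure n → Fin n → Fin n → Bool
entry G i j = lookup (lookup G i) j

degree : Structure n → Fin n → ℕ
degree {n} G a = ∑[ b ∈ allFin n ] 𝟙 (entry G a b)

-- In each of the n columns of row `a` exactly one of the entry and its negation counts. The column
-- `b = a` is among those counted, so it has to be treated separately when edges are switched.
nonNeighbours : ∀ (G : Structure n) a → degree G a ≤ k →
                n ∸ k ≤ (∑[ b ∈ allFin n ] 𝟙 (not (entry G a b)))
nonNeighbours {n} {k} G a deg≤k = m≤n+o⇒m∸n≤o n k (begin
  n                                                           ≡⟨ *-identityʳ n ⟨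
  n * 1                                                       ≡⟨ ∑-allFin-const n 1 ⟨
  (∑[ b ∈ allFin n ] 1)                                       ≡⟨ ∑-cong (allFin n) (λ b → 𝟙+𝟙-not (entry G a b)) ⟨
  (∑[ b ∈ allFin n ] (𝟙 (entry G a b) + 𝟙 (not (entry G a b)))) ≡⟨ ∑-+ (allFin n) _ _ ⟩
  degree G a + (∑[ b ∈ allFin n ] 𝟙 (not (entry G a b)))      ≤⟨ +-monoˡ-≤ _ deg≤k ⟩
  k + (∑[ b ∈ allFin n ] 𝟙 (not (entry G a b)))               ∎)
  where open ≤-Reasoning

-- The indicator of the unordered pair: with both orders in the disjunction, swapping `i` and `j`
-- only swaps the disjuncts.
isPair : (a b i j : Fin n) → Bool
isPair a b i j = does ((a ≟ i ×-dec b ≟ j) ⊎-dec (a ≟ j ×-dec b ≟ i))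

-- Flipping the edge, instead of inserting it, makes the switch its own inverse and hence a
-- permutation of the graphs.
toggle : (a b : Fin n) → Structure n → Structure n
toggle a b G = tabulate λ i → tabulate λ j → entry G i j xor isPair a b i j

entry-toggle : ∀ (a b : Fin n) G i j →
               entry (toggle a b G) i j ≡ entry G i j xor isPair a b i j
entry-toggle a b G i j =
  trans (cong (λ row → lookup row j) (lookup∘tabulate _ i)) (lookup∘tabulate _ j)

toggle-involutive : ∀ (a b : Fin n) G → toggle a b (toggle a b G) ≡ G
toggle-involutive a b G = trans (tabulate-cong rows) (tabulate∘lookup G)
  where
  entries : ∀ i j → entry (toggle a b G) i j xor isPair a b i j ≡ entry G i j
  entries i j = begin
    entry (toggle a b G) i j xor p    ≡⟨ cong (_xor p) (entry-toggle a b G i j) ⟩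
    (entry G i j xor p) xor p         ≡⟨ xor-assoc (entry G i j) p p ⟩
    entry G i j xor (p xor p)         ≡⟨ cong (entry G i j xor_) (xor-same p) ⟩
    entry G i j xor false             ≡⟨ xor-identityʳ _ ⟩
    entry G i j                       ∎
    where
    open ≡-Reasoning
    p = isPair a b i j
  rows : ∀ i → tabulate (λ j → entry (toggle a b G) i j xor isPair a b i j) ≡ lookup G i
  rows i = trans (tabulate-cong (entries i)) (tabulate∘lookup (lookup G i))

module _ {a b : Fin n} (a≢b : a ≢ b) where

  isPair-irrefl : ∀ i → isPair a b i i ≡ false
  isPair-irrefl i = dec-false ((a ≟ i ×-dec b ≟ i) ⊎-dec (a ≟ i ×-dec b ≟ i)) λ where
    (inj₁ (refl , refl)) → a≢b refl
    (inj₂ (refl , refl)) → a≢b refl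

  -- In row `a` the reversed pair would require `b = a`, so only column `b` is affected.
  isPair-row : ∀ j → isPair a b a j ≡ does (b ≟ j)
  isPair-row j with a ≟ a | b ≟ a | b ≟ j | a ≟ j
  ... | no a≢a | _        | _     | _     = ⊥-elim (a≢a refl)
  ... | _      | yes refl | _     | _     = ⊥-elim (a≢b refl)
  ... | yes _  | no _     | yes _ | _     = refl
  ... | yes _  | no _     | no _  | yes _ = refl
  ... | yes _  | no _     | no _  | no _  = refl

  -- The flipped positions form a symmetric set that avoids the diagonal because `a ≢ b`.
  toggle-isGraph : ∀ G → IsGraph G → IsGraph (toggle a b G)
  toggle-isGraph G (s , r) =
    (λ {i} {j} → subst T (symmetric i j)) ,
    (λ {i} → λ { refl e → r {i} refl (subst T (diagonal i) e) })
    where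
    symmetric : ∀ i j → entry (toggle a b G) i j ≡ entry (toggle a b G) j i
    symmetric i j = begin
      entry (toggle a b G) i j           ≡⟨ entry-toggle a b G i j ⟩
      entry G i j xor isPair a b i j     ≡⟨ cong₂ _xor_ (T-ext s s) (∨-comm (does (a ≟ i ×-dec b ≟ j)) _) ⟩
      entry G j i xor isPair a b j i     ≡⟨ entry-toggle a b G j i ⟨
      entry (toggle a b G) j i           ∎
      where open ≡-Reasoning
    diagonal : ∀ i → entry (toggle a b G) i i ≡ entry G i i
    diagonal i = trans (entry-toggle a b G i i)
      (trans (cong (entry G i i xor_) (isPair-irrefl i)) (xor-identityʳ _))

  toggle-↭ : map (toggle a b) (graphs n) ↭ graphs n
  toggle-↭ = involution-↭ (toggle a b) (toggle-involutive a b)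
    (λ G G∈ → graphs-complete _ (toggle-isGraph G (graphs-sound G∈))) (graphs-unique n)

  toggle-edge : ∀ G → entry (toggle a b G) a b ≡ not (entry G a b)
  toggle-edge G = begin
    entry (toggle a b G) a b       ≡⟨ entry-toggle a b G a b ⟩
    entry G a b xor isPair a b a b ≡⟨ cong (entry G a b xor_) (trans (isPair-row b) (dec-true (b ≟ b) refl)) ⟩
    entry G a b xor true           ≡⟨ xor-true (entry G a b) ⟩
    not (entry G a b)              ∎
    where
    open ≡-Reasoning
    xor-true : ∀ x → x xor true ≡ not x
    xor-true true  = refl
    xor-true false = refl

  -- Row `a` changes in column `b` only. Bounding the xor by a sum covers both the added and the
  -- removed edge.
  toggle-degree : ∀ G → degree (toggle a b G) a ≤ suc (degree G a)
  toggle-degree G = begin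
    degree (toggle a b G) a                                       ≤⟨ ∑-mono (allFin n) (λ j _ → bound j) ⟩
    (∑[ j ∈ allFin n ] (𝟙 (does (b ≟ j)) + 𝟙 (entry G a j)))      ≡⟨ ∑-+ (allFin n) _ _ ⟩
    (∑[ j ∈ allFin n ] 𝟙 (does (b ≟ j))) + degree G a             ≤⟨ +-monoˡ-≤ _ (∑-δ b) ⟩
    suc (degree G a)                                              ∎
    where
    open ≤-Reasoning
    bound : ∀ j → 𝟙 (entry (toggle a b G) a j) ≤ 𝟙 (does (b ≟ j)) + 𝟙 (entry G a j)
    bound j = begin
      𝟙 (entry (toggle a b G) a j)            ≡⟨ cong 𝟙 (entry-toggle a b G a j) ⟩
      𝟙 (entry G a j xor isPair a b a j)      ≤⟨ 𝟙-xor (entry G a j) _ ⟩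
      𝟙 (entry G a j) + 𝟙 (isPair a b a j)    ≡⟨ +-comm (𝟙 (entry G a j)) _ ⟩
      𝟙 (isPair a b a j) + 𝟙 (entry G a j)    ≡⟨ cong (λ x → 𝟙 x + 𝟙 (entry G a j)) (isPair-row j) ⟩
      𝟙 (does (b ≟ j)) + 𝟙 (entry G a j)      ∎

-- Counting the graphs in which a fixed node has low degree.

lowDegree : ℕ → Structure n → Fin n → ℕ
lowDegree k G a = 𝟙 (does (degree G a ≤? k))

-- For `a ≢ b`, toggling sends each graph counted on the left to one counted on the right, and it
-- permutes all graphs. For `a = b` there is no edge to switch; each left term is at most 1, which
-- the indicator of `a = b` pays for.
lowDegree-switch : ∀ k (a b : Fin n) →
  (∑[ G ∈ graphs n ] lowDegree k G a * 𝟙 (not (entry G a b))) ≤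
  (∑[ G ∈ graphs n ] (𝟙 (does (a ≟ b)) + lowDegree (suc k) G a * 𝟙 (entry G a b)))
lowDegree-switch {n} k a b with a ≟ b
... | yes _ = ∑-mono (graphs n) λ G _ →
  ≤-trans (*-mono-≤ (𝟙≤1 (does (degree G a ≤? k))) (𝟙≤1 (not (entry G a b)))) (s≤s z≤n)
... | no a≢b = begin
  (∑[ G ∈ graphs n ] lowDegree k G a * 𝟙 (not (entry G a b)))
    ≤⟨ ∑-mono (graphs n) (λ G _ → *-mono-≤
         (𝟙-mono (degree G a ≤? k) (degree (toggle a b G) a ≤? suc k)
           λ d≤k → ≤-trans (toggle-degree a≢b G) (s≤s d≤k))
         (≤-reflexive (cong 𝟙 (sym (toggle-edge a≢b G))))) ⟩
  -- The summand is now a function of the toggled graph alone, so the sum can be reindexed.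
  (∑[ G ∈ graphs n ] after (toggle a b G))
    ≡⟨ ∑-bij (toggle a b) after (toggle-↭ a≢b) ⟩
  (∑[ G ∈ graphs n ] after G) ∎
  where
  open ≤-Reasoning
  after : Structure n → ℕ
  after G = lowDegree (suc k) G a * 𝟙 (entry G a b)

-- Double counting of pairs of a graph `G` and a node `b`: summing over `b` first gives at least
-- `n ∸ k` for each low-degree graph before the switch, and at most `2 + k` for each graph after it.
lowDegree-count : ∀ k (a : Fin n) →
  (n ∸ k) * (∑[ G ∈ graphs n ] lowDegree k G a) ≤ length (graphs n) * (2 + k)
lowDegree-count {n} k a = begin
  (n ∸ k) * (∑[ G ∈ graphs n ] lowDegree k G a)
    ≡⟨ ∑-* (n ∸ k) (graphs n) _ ⟨
  (∑[ G ∈ graphs n ] (n ∸ k) * lowDegree k G a)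
    ≤⟨ ∑-mono (graphs n) (λ G _ → pointwise G) ⟩
  (∑[ G ∈ graphs n ] ∑[ b ∈ allFin n ] lowDegree k G a * 𝟙 (not (entry G a b)))
    ≡⟨ ∑-comm (graphs n) (allFin n) _ ⟩
  (∑[ b ∈ allFin n ] ∑[ G ∈ graphs n ] lowDegree k G a * 𝟙 (not (entry G a b)))
    ≤⟨ ∑-mono (allFin n) (λ b _ → lowDegree-switch k a b) ⟩
  (∑[ b ∈ allFin n ] ∑[ G ∈ graphs n ] (𝟙 (does (a ≟ b)) + lowDegree (suc k) G a * 𝟙 (entry G a b)))
    ≡⟨ ∑-comm (graphs n) (allFin n) _ ⟨
  (∑[ G ∈ graphs n ] ∑[ b ∈ allFin n ] (𝟙 (does (a ≟ b)) + lowDegree (suc k) G a * 𝟙 (entry G a b)))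
    ≤⟨ ∑-mono (graphs n) (λ G _ → pointwise′ G) ⟩
  (∑[ G ∈ graphs n ] (2 + k))
    ≡⟨ ∑-const (graphs n) (2 + k) ⟩
  length (graphs n) * (2 + k) ∎
  where
  open ≤-Reasoning
  pointwise : ∀ G → (n ∸ k) * lowDegree k G a ≤
                    (∑[ b ∈ allFin n ] lowDegree k G a * 𝟙 (not (entry G a b)))
  pointwise G = begin
    (n ∸ k) * lowDegree k G a
      ≤⟨ *𝟙≤𝟙* (degree G a ≤? k) (nonNeighbours G a) ⟩
    lowDegree k G a * (∑[ b ∈ allFin n ] 𝟙 (not (entry G a b)))
      ≡⟨ ∑-* (lowDegree k G a) (allFin n) _ ⟨
    (∑[ b ∈ allFin n ] lowDegree k G a * 𝟙 (not (entry G a b))) ∎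
  pointwise′ : ∀ G →
    (∑[ b ∈ allFin n ] (𝟙 (does (a ≟ b)) + lowDegree (suc k) G a * 𝟙 (entry G a b))) ≤ 2 + k
  pointwise′ G = begin
    (∑[ b ∈ allFin n ] (𝟙 (does (a ≟ b)) + lowDegree (suc k) G a * 𝟙 (entry G a b)))
      ≡⟨ ∑-+ (allFin n) _ _ ⟩
    (∑[ b ∈ allFin n ] 𝟙 (does (a ≟ b))) + (∑[ b ∈ allFin n ] lowDegree (suc k) G a * 𝟙 (entry G a b))
      ≡⟨ cong ((∑[ b ∈ allFin n ] 𝟙 (does (a ≟ b))) +_) (∑-* (lowDegree (suc k) G a) (allFin n) _) ⟩
    (∑[ b ∈ allFin n ] 𝟙 (does (a ≟ b))) + lowDegree (suc k) G a * degree G a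
      -- One for `b = a`, and at most `suc k` neighbours, since the indicator kills every larger
      -- degree.
      ≤⟨ +-mono-≤ (∑-δ a) (𝟙*≤ (degree G a ≤? suc k) λ d≤ → d≤) ⟩
    2 + k ∎

-- Semantics of exactlyNeighbours

-- The recursion of `∃^` adds quantifiers on the inside, so the witness of the innermost one is
-- obtained last and becomes the head of the vector.
∃^-elim : ∀ k {m} {G : Structure n} {ρ : Vec (Fin n) m} (φ : Formula (k + m)) →
          G , ρ ⊨ ∃^ k φ → ∃[ v ] (G , v ++ ρ ⊨ φ)
∃^-elim zero    φ p = [] , p
∃^-elim (suc k) φ p with v , a , q ← ∃^-elim k (∃′ φ) p = a ∷ v , q

⋁-elim : ∀ {m k} {G : Structure n} {ρ : Vec (Fin n) m} (φ : Vector (Formula m) k) →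
         G , ρ ⊨ ⋁ φ → ∃[ i ] (G , ρ ⊨ φ i)
⋁-elim {k = suc k} φ (inj₁ p) = zero , p
⋁-elim {k = suc k} φ (inj₂ p) with i , q ← ⋁-elim (φ ∘ suc) p = suc i , q

-- Each neighbour is an entry of `v`, so its indicator is at most the number of its occurrences
-- there. After exchanging the sums, each of the k positions contributes at most 1.
degree≤ : ∀ (G : Structure n) a (v : Vec (Fin n) k) →
          (∀ z → Adj G a z → ∃[ i ] z ≡ lookup v i) → degree G a ≤ k
degree≤ {n} {k} G a v cover = begin
  degree G a
    ≤⟨ ∑-mono (allFin n) (λ z _ → bound z) ⟩
  (∑[ z ∈ allFin n ] ∑[ i ∈ allFin k ] 𝟙 (does (lookup v i ≟ z)))
    ≡⟨ ∑-comm (allFin n) (allFin k) _ ⟩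
  (∑[ i ∈ allFin k ] ∑[ z ∈ allFin n ] 𝟙 (does (lookup v i ≟ z)))
    ≤⟨ ∑-mono (allFin k) (λ i _ → ∑-δ (lookup v i)) ⟩
  (∑[ i ∈ allFin k ] 1)
    ≡⟨ ∑-allFin-const k 1 ⟩
  k * 1
    ≡⟨ *-identityʳ k ⟩
  k ∎
  where
  open ≤-Reasoning
  term≤∑ : ∀ {xs : List A} {x} (f : A → ℕ) → x ∈ xs → f x ≤ ∑ xs f
  term≤∑ f (here refl) = m≤m+n _ _
  term≤∑ f (there x∈)  = ≤-trans (term≤∑ f x∈) (m≤n+m _ _)
  bound : ∀ z → 𝟙 (entry G a z) ≤ (∑[ i ∈ allFin k ] 𝟙 (does (lookup v i ≟ z)))
  bound z with entry G a z | cover z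
  ... | false | _ = z≤n
  ... | true  | h with i , refl ← h _ =
    ≤-trans (≤-reflexive (cong 𝟙 (sym (dec-true (lookup v i ≟ lookup v i) refl))))
            (term≤∑ (λ i′ → 𝟙 (does (lookup v i′ ≟ z))) (∈-allFin i))

-- The forward half of the equivalence in the formula says that the witnesses cover the
-- neighbourhood of `a`. In the environment the node `a` stands behind the k witnesses, hence the
-- two lookup equations.
exactlyNeighbours⇒degree≤ : ∀ k {G : Structure n} {a} →
                            G , a ∷ [] ⊨ exactlyNeighbours k → degree G a ≤ k
exactlyNeighbours⇒degree≤ k {G} {a} p with v , _ , neighbours ← ∃^-elim k _ p =
  degree≤ G a v λ z adj →
    let i , eq = ⋁-elim _ (proj₁ (neighbours z)
                   (subst (λ x → Adj G x z) (sym (lookup-++ʳ v (a ∷ []) zero)) adj))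
    in i , trans eq (lookup-++ˡ v (a ∷ []) i)

-- Counting typical graphs

-- Markov's inequality bounds n times the number of typical graphs, and summing the count for one
-- node over all nodes yields a factor n on the right; this common factor is cancelled.
typicalGraphs-count : ∀ k n → .{{NonZero n}} →
  (n ∸ k) * length (typicalGraphs (exactlyNeighbours k) n) ≤ 2 * (2 + k) * length (graphs n)
typicalGraphs-count k n = *-cancelˡ-≤ n (begin
  n * ((n ∸ k) * length (typicalGraphs φ n))
    ≡⟨ swap n (n ∸ k) _ ⟩
  (n ∸ k) * (n * length (typicalGraphs φ n))
    ≤⟨ *-monoʳ-≤ (n ∸ k) markov ⟩
  (n ∸ k) * (2 * (∑[ a ∈ allFin n ] ∑[ G ∈ graphs n ] lowDegree k G a))
    ≡⟨ swap (n ∸ k) 2 _ ⟩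
  2 * ((n ∸ k) * (∑[ a ∈ allFin n ] ∑[ G ∈ graphs n ] lowDegree k G a))
    ≡⟨ cong (2 *_) (∑-* (n ∸ k) (allFin n) _) ⟨
  2 * (∑[ a ∈ allFin n ] (n ∸ k) * (∑[ G ∈ graphs n ] lowDegree k G a))
    ≤⟨ *-monoʳ-≤ 2 (∑-mono (allFin n) λ a _ → lowDegree-count k a) ⟩
  2 * (∑[ a ∈ allFin n ] length (graphs n) * (2 + k))
    ≡⟨ cong (2 *_) (∑-allFin-const n _) ⟩
  2 * (n * (length (graphs n) * (2 + k)))
    ≡⟨ rearrange n (length (graphs n)) (2 + k) ⟩
  n * (2 * (2 + k) * length (graphs n)) ∎)
  where
  open ≤-Reasoning
  φ = exactlyNeighbours k
  swap : ∀ x y z → x * (y * z) ≡ y * (x * z)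
  swap = solve-∀
  rearrange : ∀ n g c → 2 * (n * (g * c)) ≡ n * (2 * c * g)
  rearrange = solve-∀
  solutions≤ : ∀ G → length (solutions φ G) ≤ (∑[ a ∈ allFin n ] lowDegree k G a)
  solutions≤ G = ≤-trans (≤-reflexive (length-filter-∑ (λ a → sat? G (a ∷ []) φ) (allFin n)))
    (∑-mono (allFin n) λ a _ →
      𝟙-mono (sat? G (a ∷ []) φ) (degree G a ≤? k) (exactlyNeighbours⇒degree≤ k))
  markov : n * length (typicalGraphs φ n) ≤
           2 * (∑[ a ∈ allFin n ] ∑[ G ∈ graphs n ] lowDegree k G a)
  markov = begin
    n * length (typicalGraphs φ n)
      ≡⟨ cong (n *_) (length-filter-∑ (typical? φ) (graphs n)) ⟩
    n * (∑[ G ∈ graphs n ] 𝟙 (does (typical? φ G)))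
      ≡⟨ ∑-* n (graphs n) _ ⟨
    (∑[ G ∈ graphs n ] n * 𝟙 (does (typical? φ G)))
      -- A typical graph contributes n, which is less than twice its number of solutions; any other
      -- graph contributes 0.
      ≤⟨ ∑-mono (graphs n) (λ G _ → ≤-trans (≤-reflexive (*-comm n _))
           (𝟙*≤ (typical? φ G) λ t → ≤-trans (<⇒≤ t) (*-monoʳ-≤ 2 (solutions≤ G)))) ⟩
    (∑[ G ∈ graphs n ] 2 * (∑[ a ∈ allFin n ] lowDegree k G a))
      ≡⟨ ∑-* 2 (graphs n) _ ⟩
    2 * (∑[ G ∈ graphs n ] ∑[ a ∈ allFin n ] lowDegree k G a)
      ≡⟨ cong (2 *_) (∑-comm (graphs n) (allFin n) _) ⟩
    2 * (∑[ a ∈ allFin n ] ∑[ G ∈ graphs n ] lowDegree k G a) ∎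

-- Rational estimates and the limit.

-- The fraction is nonnegative, so it equals its distance from 0. Since `ℚ./` reduces to lowest
-- terms, the cross-multiplied inequality is applied to the unnormalised fraction and carried back.
∣t/g-0∣<p/q : ∀ t g .{{_ : NonZero g}} {p q-1} .{c : Coprime p (suc q-1)} → t * suc q-1 < p * g →
              ℚ.∣ (ℤ.+ t ℚ./ g) ℚ.- 0ℚ ∣ ℚ.< mkℚ (ℤ.+ p) q-1 c
∣t/g-0∣<p/q t g@(suc g-1) {p} {q-1} {c} lt = subst (ℚ._< mkℚ (ℤ.+ p) q-1 c) (sym abs)
  (ℚ.toℚᵘ-cancel-< (ℚᵘ.<-respˡ-≃ (ℚᵘ.≃-sym (ℚ.toℚᵘ-fromℚᵘ (ℚᵘ.mkℚᵘ (ℤ.+ t) g-1)))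
    (ℚᵘ.*<* (subst₂ ℤ._<_ (ℤ.pos-* t (suc q-1)) (ℤ.pos-* p g) (ℤ.+<+ lt)))))
  where
  abs : ℚ.∣ (ℤ.+ t ℚ./ g) ℚ.- 0ℚ ∣ ≡ ℤ.+ t ℚ./ g
  abs = trans (cong ℚ.∣_∣ (ℚ.+-identityʳ (ℤ.+ t ℚ./ g)))
    (ℚ.0≤p⇒∣p∣≡p (ℚ.nonNegative⁻¹ (ℤ.+ t ℚ./ g) {{ℚ.normalize-nonNeg t g}}))

-- From m t ≤ c g and c q < m follows t / g ≤ c / m < 1 / q.
cross-bound : ∀ {m t c g q} p → .{{NonZero g}} →
              m * t ≤ c * g → c * q < m → t * q < suc p * g
cross-bound {m} {t} {c} {g} {q} p mt≤cg cq<m = *-cancelˡ-< m _ _ (begin-strict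
  m * (t * q)      ≡⟨ *-assoc m t q ⟨
  m * t * q        ≤⟨ *-monoˡ-≤ q mt≤cg ⟩
  c * g * q        ≡⟨ swap c g q ⟩
  c * q * g        <⟨ *-monoˡ-< g cq<m ⟩
  m * g            ≤⟨ *-monoʳ-≤ m (m≤m+n g (p * g)) ⟩
  m * (suc p * g)  ∎)
  where
  open ≤-Reasoning
  swap : ∀ x y z → x * y * z ≡ x * z * y
  swap = solve-∀

proposition6p2 : ∀ (k : ℕ) → k ≥ 1 → d-typ (exactlyNeighbours k) ≔ 0ℚ
-- With c = 2(2 + k) and q the denominator of ε, this bound on n amounts to c q < n - k, which gives
-- c / (n - k) < 1 / q ≤ ε.
proposition6p2 k _ (mkℚ ℤ.+[1+ p ] q-1 _) 0<ε = suc (k + 2 * (2 + k) * suc q-1) , λ n n≥N →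
  ∣t/g-0∣<p/q (length (typicalGraphs (exactlyNeighbours k) n)) (length (graphs n))
    {{graphs-nonZero n}}
    (cross-bound {m = n ∸ k} {c = 2 * (2 + k)} p {{graphs-nonZero n}}
      -- The threshold is a successor, so n is positive.
      (typicalGraphs-count k n {{>-nonZero (≤-trans (s≤s z≤n) n≥N)}})
      (threshold n n≥N))
  where
  threshold : ∀ n → k + 2 * (2 + k) * suc q-1 < n → 2 * (2 + k) * suc q-1 < n ∸ k
  threshold n lt = m+n≤o⇒m≤o∸n _ (≤-trans (≤-reflexive (cong suc (+-comm _ k))) lt)
proposition6p2 k _ (mkℚ ℤ.+0 _ _)       0<ε = ⊥-elim (ℚ.positive 0<ε .ℤ.Positive.pos)
proposition6p2 k _ (mkℚ ℤ.-[1+ _ ] _ _) 0<ε = ⊥-elim (ℚ.positive 0<ε .ℤ.Positive.pos)
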